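{- Let $p$ be an odd prime and $r$ a positive integer. Then $$\sum_{k=0}^{p^r-1}\frac{4k+1}{(-64)^k}\binom{2k}{k}^3\equiv(-1)^{\frac{(p-1)r}{2}}p^r\pmod{p^{r+2}}.$$
   Context: A congruence $x\equiv y\pmod{p^m}$ between rational numbers means that the $p$-adic valuation of $x-y$ is at least $m$. -}

module Defs where

open import Data.Nat.Base as ℕ using (ℕ; zero; suc)
open import Data.Nat.Divisibility using (_∣?_)
open import Data.Integer.Base as ℤ using (ℤ; +_; +0; +[1+_]; -[1+_])
open import Data.Integer.Properties using (i^n≡0⇒i≡0)
open import Data.Rational.Base using (ℚ; mkℚ; NonZero; _/_; _-_; normalize)
open import Data.Rational.Properties
  using (+-0-commutativeMonoid; normalize-pos; pos⇒nonZero; neg⇒nonZero; neg-pos)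
open import Relation.Nullary.Construct.Add.Supremum using (_⁺; ⊤⁺; [_])
open import Relation.Nullary.Decidable.Core using (does)
open import Relation.Binary.Construct.Add.Supremum.NonStrict ℤ._≤_ using (_≤⁺_)
open import Data.Bool.Base using (if_then_else_)
open import Relation.Binary.PropositionalEquality.Core using (cong)

open import Algebra.Properties.CommutativeMonoid.Sum +-0-commutativeMonoid public
  using (sum-syntax)

-- The largest k ≤ b such that p ^ k divides n.
maxExponent : (p n b : ℕ) → ℕ
maxExponent p n zero    = zero
maxExponent p n (suc b) =
  if does (p ℕ.^ suc b ∣? n) then suc b else maxExponent p n b

-- The largest k such that p ^ k divides n, for p ≥ 2 and n ≥ 1: the bound n
-- loses nothing, since p ^ k ∣ n forces k < p ^ k ≤ n.
νℕ : (p n : ℕ) → ℕ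
νℕ p n = maxExponent p n n

-- The p-adic valuation on ℚ, with values in ℤ ∪ {∞} (∞ being ⊤⁺).
ν : ℕ → ℚ → ℤ ⁺
ν p (mkℚ +0       _ _) = ⊤⁺
ν p (mkℚ +[1+ n ] d _) = [ + νℕ p (suc n) ℤ.- + νℕ p (suc d) ]
ν p (mkℚ -[1+ n ] d _) = [ + νℕ p (suc n) ℤ.- + νℕ p (suc d) ]

infix 4 _≡_[mod_^_]

_≡_[mod_^_] : ℚ → ℚ → (p m : ℕ) → Set
x ≡ y [mod p ^ m ] = [ + m ] ≤⁺ ν p (x - y)

fromℤ : ℤ → ℚ
fromℤ i = i / 1

fromℤ-nonZero : ∀ i → .{{ℤ.NonZero i}} → NonZero (fromℤ i)
fromℤ-nonZero +[1+ n ] =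
  pos⇒nonZero (fromℤ +[1+ n ]) {{normalize-pos (suc n) 1}}
fromℤ-nonZero -[1+ n ] =
  neg⇒nonZero (fromℤ -[1+ n ]) {{neg-pos {normalize (suc n) 1} (normalize-pos (suc n) 1)}}

fromℤ-^-nonZero : ∀ i k → .{{ℤ.NonZero i}} → NonZero (fromℤ (i ℤ.^ k))
fromℤ-^-nonZero i k = fromℤ-nonZero (i ℤ.^ k)
  {{ℤ.≢-nonZero λ eq → ℕ.≢-nonZero⁻¹ ℤ.∣ i ∣ (cong ℤ.∣_∣ (i^n≡0⇒i≡0 i k eq))}}

{-# OPTIONS --safe #-}
-- Write (a)_k for the rising factorial, t_k for the summand, b_n = (1/2)_n / n! and
-- u_x(j) = (1/2)_j (1/2 - x)_j / j!².  Zeilberger's method yields the exact identity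
--   ∑_{k<n} t_k = 2 n b_n ∑_{j<n} u_n(j).
-- For n = p^r = 2M + 1, four times the product (1/2 + j)(1/2 - n + j) of the factors added at
-- step j is (2j + 1 - n)² - n², and p divides n / (2j + 1 - n) unless j = M.  Hence, modulo p²,
-- u_n(j) ≡ (M C j)² for j ≤ M, whereas for M < j < n, up to a p-integral factor, u_n(j) is the
-- square of n times an entry of the Leibniz harmonic triangle, whence u_n(j) ≡ 0.  So the
-- right-hand sum is ∑_j (M C j)² = (2M C M).  Finally 2 b_n (2M C M) = (-1)^M u_n(M) exactly, and
-- u_n(M) ≡ (M C M)² = 1, so the whole is ≡ (-1)^M n modulo n p².
module Submission where

module Supercongruence where

  import Data.Rational.Properties as ℚ
  open import Algebra.Properties.CommutativeMonoid.Sum ℚ.+-0-commutativeMonoid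
    using (sum-init-last; sum-cong-≗)
  open import Data.Fin.Base using (toℕ)
  open import Data.Fin.Properties using (toℕ-inject₁; toℕ-fromℕ)
  open import Data.Integer.Base as ℤ using (ℤ; 0ℤ; 1ℤ; -1ℤ)
  import Data.Integer.Properties as ℤ
  open import Data.List.Base using ([]; _∷_)
  open import Data.Nat.Base as ℕ using (ℕ; zero; suc)
  open import Data.Nat.Combinatorics using (_C_; nCk+nC[k+1]≡[n+1]C[k+1]; k>n⇒nCk≡0; nCn≡1)
  open import Data.Nat.Coprimality using (Coprime; recompute)
  open import Data.Nat.DivMod using (m*n/n≡m)
  open import Data.Nat.Divisibility as ℕ using (_∣_; _∤_; _∣?_)
  open import Data.Nat.Primality as Prime using (Prime; euclidsLemma)
  import Data.Nat.Properties as ℕ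
  import Data.Nat.Tactic.RingSolver as ℕ-Solver
  open import Data.Product.Base using (∃; _×_; _,_)
  open import Data.Rational.Base as ℚ using (ℚ; mkℚ; 0ℚ; 1ℚ; ½; _+_; _*_; _-_; -_; 1/_; _÷_; toℚᵘ)
  open import Data.Rational.Unnormalised.Base as ℚᵘ using (mkℚᵘ; *≡*)
  import Data.Rational.Unnormalised.Properties as ℚᵘ
  open import Data.Sum.Base using (inj₁; inj₂; [_,_]′)
  open import Function.Base using (_∘_)
  open import Relation.Binary.Construct.Add.Supremum.NonStrict ℤ._≤_ using (_≤⁺_; [_]; _≤⊤⁺)
  open import Relation.Binary.PropositionalEquality
  open import Relation.Nullary.Construct.Add.Supremum using ([_])
  open import Relation.Nullary.Decidable using (yes; no; dec⇒maybe)
  open import Relation.Nullary.Negation using (contradiction)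
  open import Tactic.RingSolver using (solve; solve-∀)
  open import Tactic.RingSolver.Core.AlmostCommutativeRing
    using (AlmostCommutativeRing; fromCommutativeRing)
  open import Defs

  -- Rational arithmetic and the embeddings of ℤ and ℕ in ℚ

  ℚ-ring : AlmostCommutativeRing _ _
  ℚ-ring = fromCommutativeRing ℚ.+-*-commutativeRing (λ x → dec⇒maybe (0ℚ ℚ.≟ x))

  -- `fromℤ` normalises by a gcd that does not compute on a variable, so identities about it are
  -- checked on unnormalised fractions.
  fromℤ-toℚᵘ : ∀ i → toℚᵘ (fromℤ i) ℚᵘ.≃ mkℚᵘ i 0
  fromℤ-toℚᵘ i = ℚ.toℚᵘ-fromℚᵘ (mkℚᵘ i 0)

  fromℤ-+ : ∀ i j → fromℤ (i ℤ.+ j) ≡ fromℤ i + fromℤ j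
  fromℤ-+ i j = ℚ.toℚᵘ-injective (begin
    toℚᵘ (fromℤ (i ℤ.+ j))                ≈⟨ fromℤ-toℚᵘ (i ℤ.+ j) ⟩
    mkℚᵘ (i ℤ.+ j) 0                      ≈⟨ *≡* (cong (ℤ._* ℤ.+ 1) (cong₂ ℤ._+_ (ℤ.*-identityʳ i) (ℤ.*-identityʳ j))) ⟨
    mkℚᵘ i 0 ℚᵘ.+ mkℚᵘ j 0                ≈⟨ ℚᵘ.+-cong (fromℤ-toℚᵘ i) (fromℤ-toℚᵘ j) ⟨
    toℚᵘ (fromℤ i) ℚᵘ.+ toℚᵘ (fromℤ j)    ≈⟨ ℚ.toℚᵘ-homo-+ (fromℤ i) (fromℤ j) ⟨
    toℚᵘ (fromℤ i + fromℤ j)              ∎)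
    where open ℚᵘ.≃-Reasoning

  fromℤ-* : ∀ i j → fromℤ (i ℤ.* j) ≡ fromℤ i * fromℤ j
  fromℤ-* i j = ℚ.toℚᵘ-injective (begin
    toℚᵘ (fromℤ (i ℤ.* j))                ≈⟨ fromℤ-toℚᵘ (i ℤ.* j) ⟩
    mkℚᵘ i 0 ℚᵘ.* mkℚᵘ j 0                ≈⟨ ℚᵘ.*-cong (fromℤ-toℚᵘ i) (fromℤ-toℚᵘ j) ⟨
    toℚᵘ (fromℤ i) ℚᵘ.* toℚᵘ (fromℤ j)    ≈⟨ ℚ.toℚᵘ-homo-* (fromℤ i) (fromℤ j) ⟨
    toℚᵘ (fromℤ i * fromℤ j)              ∎)
    where open ℚᵘ.≃-Reasoning

  fromℤ-injective : ∀ i j → fromℤ i ≡ fromℤ j → i ≡ j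
  fromℤ-injective i j eq with ℚᵘ.≃-trans (ℚᵘ.≃-sym (fromℤ-toℚᵘ i))
    (ℚᵘ.≃-trans (ℚᵘ.≃-reflexive (cong toℚᵘ eq)) (fromℤ-toℚᵘ j))
  ... | *≡* e = trans (sym (ℤ.*-identityʳ i)) (trans e (ℤ.*-identityʳ j))

  -- Defined by recursion, so that ι (suc n) unfolds to 1ℚ + ι n for the ring solver.
  ι : ℕ → ℚ
  ι zero    = 0ℚ
  ι (suc n) = 1ℚ + ι n

  ι≡fromℤ : ∀ n → ι n ≡ fromℤ (ℤ.+ n)
  ι≡fromℤ zero    = refl
  ι≡fromℤ (suc n) = trans (cong (1ℚ +_) (ι≡fromℤ n)) (sym (fromℤ-+ (ℤ.+ 1) (ℤ.+ n)))

  ι-+ : ∀ m n → ι (m ℕ.+ n) ≡ ι m + ι n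
  ι-+ zero    n = sym (ℚ.+-identityˡ (ι n))
  ι-+ (suc m) n = trans (cong (1ℚ +_) (ι-+ m n)) (sym (ℚ.+-assoc 1ℚ (ι m) (ι n)))

  ι-* : ∀ m n → ι (m ℕ.* n) ≡ ι m * ι n
  ι-* zero    n = sym (ℚ.*-zeroˡ (ι n))
  ι-* (suc m) n = trans (trans (ι-+ n (m ℕ.* n)) (cong (_+_ (ι n)) (ι-* m n))) (id (ι m) (ι n))
    where
    id : ∀ x y → y + x * y ≡ (1ℚ + x) * y
    id = solve-∀ ℚ-ring

  ι-injective : ∀ {m n} → ι m ≡ ι n → m ≡ n
  ι-injective {m} {n} eq =
    ℤ.+-injective (fromℤ-injective (ℤ.+ m) (ℤ.+ n) (trans (sym (ι≡fromℤ m)) (trans eq (ι≡fromℤ n))))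

  ι-suc≢0 : ∀ n → ι (suc n) ≢ 0ℚ
  ι-suc≢0 n eq with ι-injective {suc n} {0} eq
  ... | ()

  *-cancelˡ-≢0 : ∀ {c x y} → c ≢ 0ℚ → c * x ≡ c * y → x ≡ y
  *-cancelˡ-≢0 {c} {x} {y} c≢0 eq = begin
    x                  ≡⟨ ℚ.*-identityˡ x ⟨
    1ℚ * x             ≡⟨ cong (_* x) (ℚ.*-inverseˡ c) ⟨
    1/ c * c * x       ≡⟨ ℚ.*-assoc (1/ c) c x ⟩
    1/ c * (c * x)     ≡⟨ cong (1/ c *_) eq ⟩
    1/ c * (c * y)     ≡⟨ ℚ.*-assoc (1/ c) c y ⟨
    1/ c * c * y       ≡⟨ cong (_* y) (ℚ.*-inverseˡ c) ⟩
    1ℚ * y             ≡⟨ ℚ.*-identityˡ y ⟩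
    y                  ∎
    where
    open ≡-Reasoning
    instance c-nonZero = ℚ.≢-nonZero c≢0

  1/suc : ℕ → ℚ
  1/suc n = (1/ ι (suc n)) {{ℚ.≢-nonZero (ι-suc≢0 n)}}

  1/suc-inverse : ∀ n → 1/suc n * ι (suc n) ≡ 1ℚ
  1/suc-inverse n = ℚ.*-inverseˡ (ι (suc n)) {{ℚ.≢-nonZero (ι-suc≢0 n)}}

  x-y≡0⇒x≡y : ∀ {x y} → x - y ≡ 0ℚ → x ≡ y
  x-y≡0⇒x≡y {x} {y} eq = begin
    x            ≡⟨ id x y ⟩
    x - y + y    ≡⟨ cong (_+ y) eq ⟩
    0ℚ + y       ≡⟨ ℚ.+-identityˡ y ⟩
    y            ∎
    where
    open ≡-Reasoning
    id : ∀ x y → x ≡ x - y + y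
    id = solve-∀ ℚ-ring

  -- The ring solver takes no hypotheses. If the goal is a linear combination of known equations,
  -- naming the cofactors `k`, `l`, `m` leaves a pure ring identity for it.
  linear₁ : ∀ {a b x y} k → a ≡ b → x - y ≡ k * (a - b) → x ≡ y
  linear₁ {a} k refl eq = x-y≡0⇒x≡y (trans eq (solve (k ∷ a ∷ []) ℚ-ring))

  linear₂ : ∀ {a b c d x y} k l → a ≡ b → c ≡ d → x - y ≡ k * (a - b) + l * (c - d) → x ≡ y
  linear₂ {a} {c = c} k l refl refl eq =
    x-y≡0⇒x≡y (trans eq (solve (k ∷ a ∷ l ∷ c ∷ []) ℚ-ring))

  linear₃ : ∀ {a b c d e f x y} k l m → a ≡ b → c ≡ d → e ≡ f →
            x - y ≡ k * (a - b) + l * (c - d) + m * (e - f) → x ≡ y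
  linear₃ {a} {c = c} {e = e} k l m refl refl refl eq =
    x-y≡0⇒x≡y (trans eq (solve (k ∷ a ∷ l ∷ c ∷ m ∷ e ∷ []) ℚ-ring))

  -- Divisibility by powers of p in ℤ₍ₚ₎

  -- Euclid's lemma moves one factor p at a time into n, since b can absorb none.
  ^∣*⇒^∣ : ∀ {p b} → Prime p → p ∤ b → ∀ m n → p ℕ.^ m ∣ n ℕ.* b → p ℕ.^ m ∣ n
  ^∣*⇒^∣ p-prime p∤b zero    n _ = ℕ.1∣ n
  ^∣*⇒^∣ {p} {b} p-prime p∤b (suc m) n pᵐ⁺¹∣nb
    with euclidsLemma n b p-prime (ℕ.∣-trans (ℕ.m∣m*n (p ℕ.^ m)) pᵐ⁺¹∣nb)
  ... | inj₂ p∣b = contradiction p∣b p∤b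
  ... | inj₁ (ℕ.divides-refl q) = subst (p ℕ.* p ℕ.^ m ∣_) (ℕ.*-comm p q)
    (ℕ.*-monoʳ-∣ p (^∣*⇒^∣ p-prime p∤b m q
      (ℕ.*-cancelˡ-∣ p {{Prime.prime⇒nonZero p-prime}}
        (subst (p ℕ.* p ℕ.^ m ∣_) (trans (cong (ℕ._* b) (ℕ.*-comm q p)) (ℕ.*-assoc p q b)) pᵐ⁺¹∣nb))))

  n<p^n : ∀ {p} → 1 ℕ.< p → ∀ n → n ℕ.< p ℕ.^ n
  n<p^n 1<p zero    = ℕ.z<s
  n<p^n {p} 1<p (suc n) = ℕ.≤-<-trans (n<p^n 1<p n)
    (subst (p ℕ.^ n ℕ.<_) (ℕ.*-comm (p ℕ.^ n) p)
      (ℕ.m<m*n (p ℕ.^ n) p {{ℕ.>-nonZero (ℕ.≤-<-trans ℕ.z≤n (n<p^n 1<p n))}} 1<p))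

  maxExponent-≥ : ∀ p n b {m} → p ℕ.^ m ∣ n → m ℕ.≤ b → m ℕ.≤ maxExponent p n b
  maxExponent-≥ p n zero    pᵐ∣n m≤b = m≤b
  maxExponent-≥ p n (suc b) pᵐ∣n m≤b with p ℕ.^ suc b ∣? n
  ... | yes _ = m≤b
  ... | no pᵇ∤n = maxExponent-≥ p n b pᵐ∣n
    (ℕ.≤-pred (ℕ.≤∧≢⇒< m≤b λ { refl → pᵇ∤n pᵐ∣n }))

  maxExponent-∤ : ∀ p n b → p ∤ n → maxExponent p n b ≡ 0
  maxExponent-∤ p n zero    p∤n = refl
  maxExponent-∤ p n (suc b) p∤n with p ℕ.^ suc b ∣? n
  ... | yes pᵇ∣n = contradiction (ℕ.∣-trans (ℕ.m∣m*n (p ℕ.^ b)) pᵇ∣n) p∤n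
  ... | no _     = maxExponent-∤ p n b p∤n

  -- From m < p^m ≤ n, the exponent m lies within the range that `maxExponent` searches.
  νℕ-≥ : ∀ {p} → 1 ℕ.< p → ∀ {m n} → .{{ℕ.NonZero n}} → p ℕ.^ m ∣ n → m ℕ.≤ νℕ p n
  νℕ-≥ {p} 1<p {m} {n} pᵐ∣n =
    maxExponent-≥ p n n pᵐ∣n (ℕ.<⇒≤ (ℕ.<-≤-trans (n<p^n 1<p m) (ℕ.∣⇒≤ pᵐ∣n)))

  -- p ^ m divides x in the localisation ℤ₍ₚ₎.
  record Divides (p m : ℕ) (x : ℚ) : Set where
    constructor mkDivides
    field
      num      : ℤ
      den      : ℕ
      p∤den    : p ∤ den
      equality : x * ι den ≡ fromℤ num * ι (p ℕ.^ m)

  mkℚ-*-denominator : ∀ n d .(c : Coprime ℤ.∣ n ∣ (suc d)) → mkℚ n d c * ι (suc d) ≡ fromℤ n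
  mkℚ-*-denominator n d c = trans (cong (mkℚ n d c *_) (ι≡fromℤ (suc d)))
    (ℚ.toℚᵘ-injective (begin
      toℚᵘ (x * y)             ≈⟨ ℚ.toℚᵘ-homo-* x y ⟩
      toℚᵘ x ℚᵘ.* toℚᵘ y       ≈⟨ ℚᵘ.*-congˡ {toℚᵘ x} (fromℤ-toℚᵘ (ℤ.+ suc d)) ⟩
      mkℚᵘ n d ℚᵘ.* mkℚᵘ (ℤ.+ suc d) 0
        ≈⟨ *≡* (trans (ℤ.*-identityʳ _) (cong (λ k → n ℤ.* (ℤ.+ suc k)) (sym (ℕ.*-identityʳ d)))) ⟩
      mkℚᵘ n 0                 ≈⟨ fromℤ-toℚᵘ n ⟨
      toℚᵘ (fromℤ n)           ∎))
    where
    open ℚᵘ.≃-Reasoning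
    x = mkℚ n d c
    y = fromℤ (ℤ.+ suc d)

  module _ {p : ℕ} (p-prime : Prime p) where

    private
      1<p : 1 ℕ.< p
      1<p = ℕ.nonTrivial⇒n>1 p {{Prime.prime⇒nonTrivial p-prime}}

      instance p-nonZero = Prime.prime⇒nonZero p-prime

    -- Clearing both denominators gives n b = a (d + 1) p^m in ℤ. After passing to absolute values,
    -- the factor b is removed because p does not divide it.
    numerator-∣ : ∀ {m n d} .{c : Coprime ℤ.∣ n ∣ (suc d)} → Divides p m (mkℚ n d c) → p ℕ.^ m ∣ ℤ.∣ n ∣
    numerator-∣ {m} {n} {d} {c} (mkDivides a b p∤b eq) = ^∣*⇒^∣ p-prime p∤b m ℤ.∣ n ∣
      (ℕ.divides (ℤ.∣ a ∣ ℕ.* suc d) abs-eq)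
      where
      open ≡-Reasoning
      id : ∀ x y z → x * y * z ≡ x * z * y
      id = solve-∀ ℚ-ring
      ℚ-eq : fromℤ (n ℤ.* (ℤ.+ b)) ≡ fromℤ (a ℤ.* (ℤ.+ suc d) ℤ.* (ℤ.+ (p ℕ.^ m)))
      ℚ-eq = begin
        fromℤ (n ℤ.* (ℤ.+ b))              ≡⟨ fromℤ-* n (ℤ.+ b) ⟩
        fromℤ n * fromℤ (ℤ.+ b)            ≡⟨ cong₂ _*_ (mkℚ-*-denominator n d c) (ι≡fromℤ b) ⟨
        mkℚ n d c * ι (suc d) * ι b        ≡⟨ id (mkℚ n d c) (ι (suc d)) (ι b) ⟩
        mkℚ n d c * ι b * ι (suc d)        ≡⟨ cong (_* ι (suc d)) eq ⟩
        fromℤ a * ι (p ℕ.^ m) * ι (suc d)  ≡⟨ id (fromℤ a) (ι (p ℕ.^ m)) (ι (suc d)) ⟩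
        fromℤ a * ι (suc d) * ι (p ℕ.^ m)
          ≡⟨ cong₂ (λ x y → fromℤ a * x * y) (ι≡fromℤ (suc d)) (ι≡fromℤ (p ℕ.^ m)) ⟩
        fromℤ a * fromℤ (ℤ.+ suc d) * fromℤ (ℤ.+ (p ℕ.^ m))
          ≡⟨ cong (_* fromℤ (ℤ.+ (p ℕ.^ m))) (fromℤ-* a (ℤ.+ suc d)) ⟨
        fromℤ (a ℤ.* (ℤ.+ suc d)) * fromℤ (ℤ.+ (p ℕ.^ m))
          ≡⟨ fromℤ-* (a ℤ.* (ℤ.+ suc d)) (ℤ.+ (p ℕ.^ m)) ⟨
        fromℤ (a ℤ.* (ℤ.+ suc d) ℤ.* (ℤ.+ (p ℕ.^ m))) ∎
      abs-eq : ℤ.∣ n ∣ ℕ.* b ≡ ℤ.∣ a ∣ ℕ.* suc d ℕ.* p ℕ.^ m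
      abs-eq = begin
        ℤ.∣ n ∣ ℕ.* b                               ≡⟨ ℤ.∣i*j∣≡∣i∣*∣j∣ n (ℤ.+ b) ⟨
        ℤ.∣ n ℤ.* (ℤ.+ b) ∣                         ≡⟨ cong ℤ.∣_∣ (fromℤ-injective (n ℤ.* (ℤ.+ b)) (a ℤ.* (ℤ.+ suc d) ℤ.* (ℤ.+ (p ℕ.^ m))) ℚ-eq) ⟩
        ℤ.∣ a ℤ.* (ℤ.+ suc d) ℤ.* (ℤ.+ (p ℕ.^ m)) ∣  ≡⟨ ℤ.∣i*j∣≡∣i∣*∣j∣ (a ℤ.* (ℤ.+ suc d)) (ℤ.+ (p ℕ.^ m)) ⟩
        ℤ.∣ a ℤ.* (ℤ.+ suc d) ∣ ℕ.* p ℕ.^ m          ≡⟨ cong (ℕ._* p ℕ.^ m) (ℤ.∣i*j∣≡∣i∣*∣j∣ a (ℤ.+ suc d)) ⟩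
        ℤ.∣ a ∣ ℕ.* suc d ℕ.* p ℕ.^ m               ∎

    -- A numerator divisible by p forces the reduced denominator to be prime to p.
    νℕ-difference-≥ : ∀ {m n d} .{{_ : ℕ.NonZero n}} → .(Coprime n d) → p ℕ.^ suc m ∣ n →
                      ℤ.+ suc m ℤ.≤ (ℤ.+ νℕ p n) ℤ.- (ℤ.+ νℕ p d)
    νℕ-difference-≥ {m} {n} {d} c pᵐ⁺¹∣n = subst (ℤ.+ suc m ℤ.≤_)
      (sym (trans (cong (λ k → (ℤ.+ νℕ p n) ℤ.- (ℤ.+ k)) (maxExponent-∤ p d d p∤d)) (ℤ.+-identityʳ _)))
      (ℤ.+≤+ (νℕ-≥ 1<p pᵐ⁺¹∣n))
      where
      p∤d : p ∤ d
      p∤d p∣d = ℕ.<⇒≢ 1<p (sym (recompute c (ℕ.∣-trans (ℕ.m∣m*n (p ℕ.^ m)) pᵐ⁺¹∣n , p∣d)))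

    -- The exponent is a successor, so that p divides the reduced numerator and coprimality keeps p
    -- out of the reduced denominator; numerator zero has valuation ∞.
    Divides⇒≤ν : ∀ {m} x → Divides p (suc m) x → [ ℤ.+ suc m ] ≤⁺ ν p x
    Divides⇒≤ν (mkℚ ℤ.+0       d c) _ = _ ≤⊤⁺
    Divides⇒≤ν (mkℚ ℤ.+[1+ n ] d c) h = [ νℕ-difference-≥ c (numerator-∣ h) ]
    Divides⇒≤ν (mkℚ ℤ.-[1+ n ] d c) h = [ νℕ-difference-≥ c (numerator-∣ h) ]

    p∤1 : p ∤ 1
    p∤1 p∣1 = ℕ.<⇒≢ 1<p (sym (ℕ.∣1⇒≡1 p∣1))

    p∤* : ∀ {a b} → p ∤ a → p ∤ b → p ∤ a ℕ.* b
    p∤* {a} {b} p∤a p∤b p∣ab = [ p∤a , p∤b ]′ (euclidsLemma a b p-prime p∣ab)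

    Divides-fromℤ : ∀ i → Divides p 0 (fromℤ i)
    Divides-fromℤ i = mkDivides i 1 p∤1 refl

    Divides-ι : ∀ n → Divides p 0 (ι n)
    Divides-ι n = subst (Divides p 0) (sym (ι≡fromℤ n)) (Divides-fromℤ (ℤ.+ n))

    Divides-p^ : ∀ m → Divides p m (ι (p ℕ.^ m))
    Divides-p^ m = mkDivides 1ℤ 1 p∤1 (ℚ.*-comm (ι (p ℕ.^ m)) 1ℚ)

    Divides-- : ∀ {m x} → Divides p m x → Divides p m (- x)
    -- The numerator is written as a product with -1 so that `fromℤ-*` applies.
    Divides-- {m} {x} (mkDivides a b p∤b eq) = mkDivides (-1ℤ ℤ.* a) b p∤b
      (trans (linear₁ {x = - x * ι b} (- 1ℚ) eq (id x (ι b) (fromℤ a) (ι (p ℕ.^ m))))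
             (cong (_* ι (p ℕ.^ m)) (sym (fromℤ-* -1ℤ a))))
      where
      id : ∀ x b a q → - x * b - (- 1ℚ) * a * q ≡ (- 1ℚ) * (x * b - a * q)
      id = solve-∀ ℚ-ring

    Divides-+ : ∀ {m x y} → Divides p m x → Divides p m y → Divides p m (x + y)
    Divides-+ {m} {x} {y} (mkDivides a b p∤b eq) (mkDivides a′ b′ p∤b′ eq′) =
      mkDivides (a ℤ.* (ℤ.+ b′) ℤ.+ a′ ℤ.* (ℤ.+ b)) (b ℕ.* b′) (p∤* p∤b p∤b′) (begin
        (x + y) * ι (b ℕ.* b′)                ≡⟨ cong ((x + y) *_) (ι-* b b′) ⟩
        (x + y) * (ι b * ι b′)
          ≡⟨ linear₂ (ι b′) (ι b) eq eq′ (id x y (ι b) (ι b′) (fromℤ a) (fromℤ a′) (ι (p ℕ.^ m))) ⟩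
        (fromℤ a * ι b′ + fromℤ a′ * ι b) * ι (p ℕ.^ m)
          ≡⟨ cong (_* ι (p ℕ.^ m)) (cong₂ _+_ (cong (fromℤ a *_) (ι≡fromℤ b′)) (cong (fromℤ a′ *_) (ι≡fromℤ b))) ⟩
        (fromℤ a * fromℤ (ℤ.+ b′) + fromℤ a′ * fromℤ (ℤ.+ b)) * ι (p ℕ.^ m)
          ≡⟨ cong (_* ι (p ℕ.^ m)) (cong₂ _+_ (fromℤ-* a (ℤ.+ b′)) (fromℤ-* a′ (ℤ.+ b))) ⟨
        (fromℤ (a ℤ.* (ℤ.+ b′)) + fromℤ (a′ ℤ.* (ℤ.+ b))) * ι (p ℕ.^ m)
          ≡⟨ cong (_* ι (p ℕ.^ m)) (fromℤ-+ (a ℤ.* (ℤ.+ b′)) (a′ ℤ.* (ℤ.+ b))) ⟨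
        fromℤ (a ℤ.* (ℤ.+ b′) ℤ.+ a′ ℤ.* (ℤ.+ b)) * ι (p ℕ.^ m) ∎)
      where
      open ≡-Reasoning
      id : ∀ x y b b′ a a′ q → (x + y) * (b * b′) - (a * b′ + a′ * b) * q
           ≡ b′ * (x * b - a * q) + b * (y * b′ - a′ * q)
      id = solve-∀ ℚ-ring

    Divides-* : ∀ {m n x y} → Divides p m x → Divides p n y → Divides p (m ℕ.+ n) (x * y)
    Divides-* {m} {n} {x} {y} (mkDivides a b p∤b eq) (mkDivides a′ b′ p∤b′ eq′) =
      mkDivides (a ℤ.* a′) (b ℕ.* b′) (p∤* p∤b p∤b′) (begin
        x * y * ι (b ℕ.* b′)                  ≡⟨ cong (x * y *_) (ι-* b b′) ⟩
        x * y * (ι b * ι b′)                  ≡⟨ interchange x y (ι b) (ι b′) ⟩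
        (x * ι b) * (y * ι b′)                ≡⟨ cong₂ _*_ eq eq′ ⟩
        (fromℤ a * ι (p ℕ.^ m)) * (fromℤ a′ * ι (p ℕ.^ n))
          ≡⟨ interchange (fromℤ a) (ι (p ℕ.^ m)) (fromℤ a′) (ι (p ℕ.^ n)) ⟩
        (fromℤ a * fromℤ a′) * (ι (p ℕ.^ m) * ι (p ℕ.^ n))
          ≡⟨ cong₂ _*_ (fromℤ-* a a′) (ι-* (p ℕ.^ m) (p ℕ.^ n)) ⟨
        fromℤ (a ℤ.* a′) * ι (p ℕ.^ m ℕ.* p ℕ.^ n)
          ≡⟨ cong (λ k → fromℤ (a ℤ.* a′) * ι k) (ℕ.^-distribˡ-+-* p m n) ⟨
        fromℤ (a ℤ.* a′) * ι (p ℕ.^ (m ℕ.+ n)) ∎)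
      where
      open ≡-Reasoning
      interchange : ∀ x y z w → x * y * (z * w) ≡ (x * z) * (y * w)
      interchange = solve-∀ ℚ-ring

    Divides-weaken : ∀ {m x} → Divides p m x → Divides p 0 x
    Divides-weaken {m} {x} (mkDivides a b p∤b eq) = mkDivides (a ℤ.* (ℤ.+ (p ℕ.^ m))) b p∤b (begin
      x * ι b                                 ≡⟨ eq ⟩
      fromℤ a * ι (p ℕ.^ m)                   ≡⟨ cong (fromℤ a *_) (ι≡fromℤ (p ℕ.^ m)) ⟩
      fromℤ a * fromℤ (ℤ.+ (p ℕ.^ m))         ≡⟨ fromℤ-* a (ℤ.+ (p ℕ.^ m)) ⟨
      fromℤ (a ℤ.* (ℤ.+ (p ℕ.^ m)))           ≡⟨ ℚ.*-identityʳ _ ⟨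
      fromℤ (a ℤ.* (ℤ.+ (p ℕ.^ m))) * 1ℚ      ∎)
      where open ≡-Reasoning

    Divides-0 : ∀ m → Divides p m 0ℚ
    Divides-0 m = mkDivides 0ℤ 1 p∤1 (sym (ℚ.*-zeroˡ (ι (p ℕ.^ m))))

    Divides-unit : ∀ {k x} → p ∤ k → x * ι k ≡ 1ℚ → Divides p 0 x
    Divides-unit {k} p∤k eq = mkDivides 1ℤ k p∤k eq

    -- Common factors p of k and p^r are cancelled one by one. As 0 < k < p^r persists, k becomes
    -- prime to p while a positive power of p is still left above it.
    Divides-p^/k : ∀ r k {x} → 0 ℕ.< k → k ℕ.< p ℕ.^ r → x * ι k ≡ ι (p ℕ.^ r) → Divides p 1 x
    Divides-p^/k zero    k 0<k k<1 eq = contradiction (ℕ.≤-<-trans 0<k k<1) (ℕ.<-irrefl refl)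
    Divides-p^/k (suc r) k {x} 0<k k<pʳ⁺¹ eq with p ∣? k
    ... | no p∤k = mkDivides (ℤ.+ (p ℕ.^ r)) k p∤k (begin
      x * ι k                                 ≡⟨ eq ⟩
      ι (p ℕ.* p ℕ.^ r)                       ≡⟨ ι-* p (p ℕ.^ r) ⟩
      ι p * ι (p ℕ.^ r)                       ≡⟨ ℚ.*-comm (ι p) _ ⟩
      ι (p ℕ.^ r) * ι p                       ≡⟨ cong₂ _*_ (ι≡fromℤ (p ℕ.^ r)) (cong ι (sym (ℕ.*-identityʳ p))) ⟩
      fromℤ (ℤ.+ (p ℕ.^ r)) * ι (p ℕ.^ 1)     ∎)
      where open ≡-Reasoning
    ... | yes (ℕ.divides-refl k′) = Divides-p^/k r k′
      (ℕ.n≢0⇒n>0 λ { refl → contradiction 0<k λ () })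
      (ℕ.*-cancelʳ-< p k′ _ (subst (k′ ℕ.* p ℕ.<_) (ℕ.*-comm p (p ℕ.^ r)) k<pʳ⁺¹))
      (*-cancelˡ-≢0 ιp≢0 (begin
        ι p * (x * ι k′)     ≡⟨ id (ι p) x (ι k′) ⟩
        x * (ι k′ * ι p)     ≡⟨ cong (x *_) (ι-* k′ p) ⟨
        x * ι (k′ ℕ.* p)     ≡⟨ eq ⟩
        ι (p ℕ.* p ℕ.^ r)    ≡⟨ ι-* p (p ℕ.^ r) ⟩
        ι p * ι (p ℕ.^ r)    ∎))
      where
      open ≡-Reasoning
      id : ∀ p x k → p * (x * k) ≡ x * (k * p)
      id = solve-∀ ℚ-ring
      ιp≢0 : ι p ≢ 0ℚ
      ιp≢0 eq = ℕ.≢-nonZero⁻¹ p (ι-injective eq)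

  -- The reduction to a partial sum of ₂F₁(1/2, 1/2 - x; 1; 1)

  2ℚ 3ℚ 4ℚ : ℚ
  2ℚ = ι 2
  3ℚ = ι 3
  4ℚ = ι 4

  *-≢0 : ∀ {x y} → x ≢ 0ℚ → y ≢ 0ℚ → x * y ≢ 0ℚ
  *-≢0 {x} x≢0 y≢0 xy≡0 = y≢0 (*-cancelˡ-≢0 x≢0 (trans xy≡0 (sym (ℚ.*-zeroʳ x))))

  2n+1≢0 : ∀ n → 2ℚ * ι n + 1ℚ ≢ 0ℚ
  2n+1≢0 n eq = ι-suc≢0 (2 ℕ.* n) (trans (cong (1ℚ +_) (ι-* 2 n)) (trans (ℚ.+-comm 1ℚ (2ℚ * ι n)) eq))

  -- Splits off the last term, as the telescoping inductions require.
  Σ< : (ℕ → ℚ) → ℕ → ℚ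
  Σ< f zero    = 0ℚ
  Σ< f (suc n) = Σ< f n + f n

  1/2suc : ℕ → ℚ
  1/2suc n = ½ * 1/suc n

  1/2suc-inverse : ∀ n → 1/2suc n * (2ℚ * (1ℚ + ι n)) ≡ 1ℚ
  1/2suc-inverse n = trans (id (1/suc n) (ι n)) (1/suc-inverse n)
    where
    id : ∀ i x → ½ * i * (2ℚ * (1ℚ + x)) ≡ i * (1ℚ + x)
    id = solve-∀ ℚ-ring

  sgn : ℕ → ℚ
  sgn zero    = 1ℚ
  sgn (suc n) = - sgn n

  fac : ℕ → ℚ
  fac zero    = 1ℚ
  fac (suc n) = (1ℚ + ι n) * fac n

  fac≢0 : ∀ n → fac n ≢ 0ℚ
  fac≢0 zero    = ι-suc≢0 0
  fac≢0 (suc n) = *-≢0 (ι-suc≢0 n) (fac≢0 n)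

  -- b n = (1/2)_n / n!
  b : ℕ → ℚ
  b zero    = 1ℚ
  b (suc n) = b n * ((2ℚ * ι n + 1ℚ) * 1/2suc n)

  -- u x j = (1/2)_j (1/2 - x)_j / j!²
  u : ℚ → ℕ → ℚ
  u x zero    = 1ℚ
  u x (suc j) = u x j * ((2ℚ * ι j + 1ℚ) * (2ℚ * ι j + 1ℚ - 2ℚ * x) * (1/2suc j * 1/2suc j))

  -- The rising factorials (-1/2 - x)_j and (1/2 - x)_j differ only in their end factors.
  -- Cross-multiplied, since 2x + 1 - 2j can vanish for rational x.
  u-shift : ∀ x j → (2ℚ * x + 1ℚ - 2ℚ * ι j) * u (1ℚ + x) j ≡ (2ℚ * x + 1ℚ) * u x j
  u-shift x zero    = id x
    where
    id : ∀ x → (2ℚ * x + 1ℚ - 2ℚ * 0ℚ) * 1ℚ ≡ (2ℚ * x + 1ℚ) * 1ℚ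
    id = solve-∀ ℚ-ring
  u-shift x (suc j) = step (ι j) (1/2suc j) (u (1ℚ + x) j) (u x j) (u-shift x j)
    where
    step : ∀ j h v w → (2ℚ * x + 1ℚ - 2ℚ * j) * v ≡ (2ℚ * x + 1ℚ) * w →
           (2ℚ * x + 1ℚ - 2ℚ * (1ℚ + j)) * (v * ((2ℚ * j + 1ℚ) * (2ℚ * j + 1ℚ - 2ℚ * (1ℚ + x)) * (h * h)))
           ≡ (2ℚ * x + 1ℚ) * (w * ((2ℚ * j + 1ℚ) * (2ℚ * j + 1ℚ - 2ℚ * x) * (h * h)))
    step j h v w eq = linear₁ ((2ℚ * j + 1ℚ) * (2ℚ * j + 1ℚ - 2ℚ * x) * (h * h)) eq
      (solve (x ∷ j ∷ h ∷ v ∷ w ∷ []) ℚ-ring)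

  -- The right-hand side is the Gosper certificate of the summed left-hand side.
  Σu-shift : ∀ x n → (2ℚ * x + 1ℚ) * ((2ℚ * x + 1ℚ) * Σ< (u (1ℚ + x)) n - 2ℚ * x * Σ< (u x) n)
                     ≡ - 4ℚ * (ι n * ι n) * u (1ℚ + x) n
  Σu-shift x zero    = id x
    where
    id : ∀ x → (2ℚ * x + 1ℚ) * ((2ℚ * x + 1ℚ) * 0ℚ - 2ℚ * x * 0ℚ) ≡ - 4ℚ * (0ℚ * 0ℚ) * 1ℚ
    id = solve-∀ ℚ-ring
  Σu-shift x (suc n) =
    step (ι n) (1/2suc n) (u (1ℚ + x) n) (u x n) (Σ< (u (1ℚ + x)) n) (Σ< (u x) n)
      (Σu-shift x n) (u-shift x n) (1/2suc-inverse n)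
    where
    step : ∀ j h v w S T →
           (2ℚ * x + 1ℚ) * ((2ℚ * x + 1ℚ) * S - 2ℚ * x * T) ≡ - 4ℚ * (j * j) * v →
           (2ℚ * x + 1ℚ - 2ℚ * j) * v ≡ (2ℚ * x + 1ℚ) * w →
           h * (2ℚ * (1ℚ + j)) ≡ 1ℚ →
           (2ℚ * x + 1ℚ) * ((2ℚ * x + 1ℚ) * (S + v) - 2ℚ * x * (T + w))
           ≡ - 4ℚ * ((1ℚ + j) * (1ℚ + j)) * (v * ((2ℚ * j + 1ℚ) * (2ℚ * j + 1ℚ - 2ℚ * (1ℚ + x)) * (h * h)))
    step j h v w S T eq₁ eq₂ eq₃ =
      -- As h enters squared, the third cofactor comes from a² - 1 = (a + 1)(a - 1) with a = 2h(1 +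
      -- j).
      linear₃ 1ℚ (2ℚ * x) (v * (2ℚ * j + 1ℚ) * (2ℚ * j + 1ℚ - 2ℚ * (1ℚ + x)) * (h * (2ℚ * (1ℚ + j)) + 1ℚ))
        eq₁ eq₂ eq₃ (solve (x ∷ j ∷ h ∷ v ∷ w ∷ S ∷ T ∷ []) ℚ-ring)

  -- P n = (1/2)_n
  P : ℕ → ℚ
  P n = b n * fac n

  P-suc : ∀ n → 2ℚ * P (suc n) ≡ (2ℚ * ι n + 1ℚ) * P n
  P-suc n = step (b n) (fac n) (1/2suc n) (ι n) (1/2suc-inverse n)
    where
    step : ∀ b f h x → h * (2ℚ * (1ℚ + x)) ≡ 1ℚ →
           2ℚ * (b * ((2ℚ * x + 1ℚ) * h) * ((1ℚ + x) * f)) ≡ (2ℚ * x + 1ℚ) * (b * f)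
    step b f h x eq = linear₁ (b * f * (2ℚ * x + 1ℚ)) eq (solve (b ∷ f ∷ h ∷ x ∷ []) ℚ-ring)

  P≢0 : ∀ n → P n ≢ 0ℚ
  P≢0 zero    = ι-suc≢0 0
  P≢0 (suc n) eq = *-≢0 (2n+1≢0 n) (P≢0 n)
    (trans (sym (P-suc n)) (trans (cong (2ℚ *_) eq) (ℚ.*-zeroʳ 2ℚ)))

  -- (1/2 - n)_j (1/2)_(n-j) = (-1)^j (1/2)_n
  u-P : ∀ j m n → j ℕ.+ m ≡ n → u (ι n) j * (fac j * fac j) * P m ≡ sgn j * P j * P n
  u-P zero    m n refl = id (P m)
    where
    id : ∀ x → 1ℚ * (1ℚ * 1ℚ) * x ≡ 1ℚ * (1ℚ * 1ℚ) * x
    id = solve-∀ ℚ-ring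
  -- The factor 4 clears the two halves hidden in `P-suc`, once at m and once at j.
  u-P (suc j) m n eq = *-cancelˡ-≢0 (ι-suc≢0 3)
    (step (u (ι n) j) (fac j) (ι j) (ι m) (ι n) (1/2suc j) (P m) (P (suc m)) (P j) (P (suc j)) (P n) (sgn j)
      (1/2suc-inverse j) (trans (cong ι (sym eq)) (ι-+ (suc j) m)) (P-suc m)
      (u-P j (suc m) n (trans (ℕ.+-suc j m) eq)) (P-suc j))
    where
    open ≡-Reasoning
    step : ∀ u f j m n h Pm Pm′ Pj Pj′ Pn s →
           h * (2ℚ * (1ℚ + j)) ≡ 1ℚ → n ≡ 1ℚ + j + m → 2ℚ * Pm′ ≡ (2ℚ * m + 1ℚ) * Pm →
           u * (f * f) * Pm′ ≡ s * Pj * Pn → 2ℚ * Pj′ ≡ (2ℚ * j + 1ℚ) * Pj →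
           4ℚ * (u * ((2ℚ * j + 1ℚ) * (2ℚ * j + 1ℚ - 2ℚ * n) * (h * h)) * ((1ℚ + j) * f * ((1ℚ + j) * f)) * Pm)
           ≡ 4ℚ * (- s * Pj′ * Pn)
    step u f j m n h Pm Pm′ Pj Pj′ Pn s eq₁ eq₂ eq₃ eq₄ eq₅ = begin
      4ℚ * (u * ((2ℚ * j + 1ℚ) * (2ℚ * j + 1ℚ - 2ℚ * n) * (h * h)) * ((1ℚ + j) * f * ((1ℚ + j) * f)) * Pm)
        ≡⟨ linear₁ (u * f * f * (2ℚ * j + 1ℚ) * (2ℚ * j + 1ℚ - 2ℚ * n) * Pm * (h * (2ℚ * (1ℚ + j)) + 1ℚ)) eq₁
             (solve (u ∷ f ∷ j ∷ m ∷ n ∷ h ∷ Pm ∷ []) ℚ-ring) ⟩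
      u * f * f * (2ℚ * j + 1ℚ) * (2ℚ * j + 1ℚ - 2ℚ * n) * Pm
        -- Since n = 1 + j + m, the factor 2j + 1 - 2n is -(2m + 1): it extends (1/2)_m to
        -- (1/2)_(m+1) and flips the sign.
        ≡⟨ linear₂ (- 2ℚ * u * f * f * (2ℚ * j + 1ℚ) * Pm) (u * f * f * (2ℚ * j + 1ℚ)) eq₂ eq₃
             (solve (u ∷ f ∷ j ∷ m ∷ n ∷ Pm ∷ Pm′ ∷ []) ℚ-ring) ⟩
      - (u * f * f * (2ℚ * j + 1ℚ) * (2ℚ * Pm′))
        ≡⟨ linear₂ (- 2ℚ * (2ℚ * j + 1ℚ)) (2ℚ * s * Pn) eq₄ eq₅
             (solve (u ∷ f ∷ j ∷ s ∷ Pm′ ∷ Pj ∷ Pj′ ∷ Pn ∷ []) ℚ-ring) ⟩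
      4ℚ * (- s * Pj′ * Pn) ∎

  -- The case m = 0 of `u-P`, divided by n!². It exposes a diagonal value of `u` inside the cubic
  -- summand `t`.
  u-diagonal : ∀ n → u (ι n) n ≡ sgn n * (b n * b n)
  u-diagonal n = *-cancelˡ-≢0 (*-≢0 (fac≢0 n) (fac≢0 n))
    (step (u (ι n) n) (b n) (fac n) (sgn n) (u-P n 0 n (ℕ.+-identityʳ n)))
    where
    step : ∀ u b f s → u * (f * f) * (1ℚ * 1ℚ) ≡ s * (b * f) * (b * f) → f * f * u ≡ f * f * (s * (b * b))
    step u b f s eq = linear₁ 1ℚ eq (solve (u ∷ b ∷ f ∷ s ∷ []) ℚ-ring)

  -- The summand of the theorem: the cube of (2n C n) = 4^n b_n cancels 64^n.
  t : ℕ → ℚ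
  t n = (4ℚ * ι n + 1ℚ) * sgn n * (b n * b n * b n)

  -- Induction on n, with `Σu-shift` at x = n. On the diagonal `u-shift` reads u_(n+1)(n) = (2n + 1)
  -- u_n(n), which eliminates u_(n+1)(n). Because 2(n + 1) b_(n+1) = (2n + 1) b_n, the right-hand
  -- side then grows by exactly t_n.
  Σt≡2nbΣu : ∀ n → Σ< t n ≡ 2ℚ * ι n * b n * Σ< (u (ι n)) n
  Σt≡2nbΣu zero    = refl
  Σt≡2nbΣu (suc n) = begin
    Σ< t n + t n
      ≡⟨ cong (_+ t n) (Σt≡2nbΣu n) ⟩
    2ℚ * ι n * b n * Σ< (u (ι n)) n + t n
      ≡⟨ step₂ (ι n) (b n) (sgn n) (u (ι n) n) (Σ< (u (ι n)) n) S′ (1/2suc n) recurrence (u-diagonal n) (1/2suc-inverse n) ⟩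
    2ℚ * ι (suc n) * b (suc n) * Σ< (u (ι (suc n))) (suc n) ∎
    where
    open ≡-Reasoning
    S′ = Σ< (u (ι (suc n))) (suc n)
    step₁ : ∀ x v w S T → (2ℚ * x + 1ℚ) * ((2ℚ * x + 1ℚ) * S - 2ℚ * x * T) ≡ - 4ℚ * (x * x) * v →
            (2ℚ * x + 1ℚ - 2ℚ * x) * v ≡ (2ℚ * x + 1ℚ) * w →
            (2ℚ * x + 1ℚ) * ((2ℚ * x + 1ℚ) * (S + v) - 2ℚ * x * T) ≡ (2ℚ * x + 1ℚ) * ((4ℚ * x + 1ℚ) * w)
    step₁ x v w S T eq₁ eq₂ = linear₂ 1ℚ (4ℚ * x + 1ℚ) eq₁ eq₂ (solve (x ∷ v ∷ w ∷ S ∷ T ∷ []) ℚ-ring)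
    recurrence : (2ℚ * ι n + 1ℚ) * S′ - 2ℚ * ι n * Σ< (u (ι n)) n ≡ (4ℚ * ι n + 1ℚ) * u (ι n) n
    recurrence = *-cancelˡ-≢0 (2n+1≢0 n)
      (step₁ (ι n) (u (ι (suc n)) n) (u (ι n) n) (Σ< (u (ι (suc n))) n) (Σ< (u (ι n)) n)
        (Σu-shift (ι n) n) (u-shift (ι n) n))
    step₂ : ∀ x b s w T S h → (2ℚ * x + 1ℚ) * S - 2ℚ * x * T ≡ (4ℚ * x + 1ℚ) * w → w ≡ s * (b * b) →
            h * (2ℚ * (1ℚ + x)) ≡ 1ℚ →
            2ℚ * x * b * T + (4ℚ * x + 1ℚ) * s * (b * b * b)
            ≡ 2ℚ * (1ℚ + x) * (b * ((2ℚ * x + 1ℚ) * h)) * S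
    step₂ x b s w T S h eq₁ eq₂ eq₃ =
      linear₃ (- b) (- (b * (4ℚ * x + 1ℚ))) (- (b * (2ℚ * x + 1ℚ) * S)) eq₁ eq₂ eq₃
        (solve (x ∷ b ∷ s ∷ w ∷ T ∷ S ∷ h ∷ []) ℚ-ring)

  -- Binomial coefficients

  c : ℕ → ℕ → ℚ
  c n k = ι (n C k)

  c-pascal : ∀ n k → c (suc n) (suc k) ≡ c n k + c n (suc k)
  c-pascal n k = trans (cong ι (sym (nCk+nC[k+1]≡[n+1]C[k+1] n k))) (ι-+ (n C k) (n C suc k))

  -- Induction along Pascal's rule. In ℚ the difference n - k may be negative, so no bound on k is
  -- imposed.
  c-absorb : ∀ n k → (1ℚ + ι k) * c n (suc k) ≡ (ι n - ι k) * c n k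
  c-absorb zero zero = refl
  c-absorb zero (suc k) =
    -- In row 0 beyond the first step, both binomial coefficients vanish although 0 - k does not.
    trans (cong ((1ℚ + ι (suc k)) *_) (cong ι (k>n⇒nCk≡0 {0} {suc (suc k)} ℕ.z<s)))
    (trans (ℚ.*-zeroʳ (1ℚ + ι (suc k)))
    (sym (trans (cong ((0ℚ - ι (suc k)) *_) (cong ι (k>n⇒nCk≡0 {0} {suc k} ℕ.z<s))) (ℚ.*-zeroʳ (0ℚ - ι (suc k))))))
  c-absorb (suc n) zero = step (ι n) (c n 1) (c (suc n) 1) (c-pascal n 0) (c-absorb n 0)
    where
    step : ∀ n d d′ → d′ ≡ (1ℚ + 0ℚ) + d → (1ℚ + 0ℚ) * d ≡ (n - 0ℚ) * (1ℚ + 0ℚ) →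
           (1ℚ + 0ℚ) * d′ ≡ (1ℚ + n - 0ℚ) * (1ℚ + 0ℚ)
    step n d d′ eq₁ eq₂ = linear₂ 1ℚ 1ℚ eq₁ eq₂ (solve (n ∷ d ∷ d′ ∷ []) ℚ-ring)
  c-absorb (suc n) (suc k) =
    step (ι n) (ι k) (c n k) (c n (suc k)) (c n (suc (suc k))) (c (suc n) (suc k)) (c (suc n) (suc (suc k)))
      (c-pascal n (suc k)) (c-absorb n (suc k)) (c-pascal n k) (c-absorb n k)
    where
    step : ∀ n k x y z y′ z′ → z′ ≡ y + z → (1ℚ + (1ℚ + k)) * z ≡ (n - (1ℚ + k)) * y →
           y′ ≡ x + y → (1ℚ + k) * y ≡ (n - k) * x → (1ℚ + (1ℚ + k)) * z′ ≡ (1ℚ + n - (1ℚ + k)) * y′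
    step n k x y z y′ z′ refl eq₁ refl eq₂ =
      linear₂ 1ℚ 1ℚ eq₁ eq₂ (solve (n ∷ k ∷ x ∷ y ∷ z ∷ []) ℚ-ring)

  -- Two Pascal steps lead from row 2n + 2 down to row 2n; absorption shows that the two middle
  -- entries of row 2n + 1 agree and evaluates them.
  c-central-suc : ∀ n → (1ℚ + ι n) * c (2 ℕ.* suc n) (suc n) ≡ 2ℚ * (2ℚ * ι n + 1ℚ) * c (2 ℕ.* n) n
  c-central-suc n = trans (cong (λ m → (1ℚ + ι n) * c m (suc n)) (ℕ.*-suc 2 n))
    (step (ι n) (c m n) (c m (suc n)) (c (suc m) n) (c (suc m) (suc n)) (c (suc (suc m)) (suc n))
      (c-pascal (suc m) n) (absorb (suc m) (cong (1ℚ +_) ιm)) (c-pascal m n) (absorb m ιm))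
    where
    m = 2 ℕ.* n
    ιm : ι m ≡ 2ℚ * ι n
    ιm = ι-* 2 n
    absorb : ∀ k {x} → ι k ≡ x → (1ℚ + ι n) * c k (suc n) ≡ (x - ι n) * c k n
    absorb k refl = c-absorb k n
    step : ∀ n x y x′ y′ y″ → y″ ≡ x′ + y′ → (1ℚ + n) * y′ ≡ (1ℚ + 2ℚ * n - n) * x′ →
           y′ ≡ x + y → (1ℚ + n) * y ≡ (2ℚ * n - n) * x →
           (1ℚ + n) * y″ ≡ 2ℚ * (2ℚ * n + 1ℚ) * x
    step n x y x′ y′ y″ refl eq₁ refl eq₂ =
      linear₂ (- 1ℚ) 2ℚ eq₁ eq₂ (solve (n ∷ x ∷ y ∷ x′ ∷ []) ℚ-ring)

  -- The certificate - (3n + 1 - 2k) (n C k)² of the Zeilberger recurrence for ∑ⱼ (n C j)².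
  Σc²-certificate : ∀ n k → (1ℚ + ι n) * Σ< (λ j → c (suc n) j * c (suc n) j) (suc k)
                            - 2ℚ * (2ℚ * ι n + 1ℚ) * Σ< (λ j → c n j * c n j) (suc k)
                            ≡ - (3ℚ * ι n + 1ℚ - 2ℚ * ι k) * (c n k * c n k)
  Σc²-certificate n zero = id (ι n)
    where
    id : ∀ x → (1ℚ + x) * (0ℚ + (1ℚ + 0ℚ) * (1ℚ + 0ℚ)) - 2ℚ * (2ℚ * x + 1ℚ) * (0ℚ + (1ℚ + 0ℚ) * (1ℚ + 0ℚ))
             ≡ - (3ℚ * x + 1ℚ - 2ℚ * 0ℚ) * ((1ℚ + 0ℚ) * (1ℚ + 0ℚ))
    id = solve-∀ ℚ-ring
  Σc²-certificate n (suc k) =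
    step (ι n) (ι k) (c n k) (c n (suc k)) (c (suc n) (suc k))
      (Σ< (λ j → c (suc n) j * c (suc n) j) (suc k)) (Σ< (λ j → c n j * c n j) (suc k))
      (Σc²-certificate n k) (c-pascal n k) (c-absorb n k)
    where
    step : ∀ n k x y y′ S T →
           (1ℚ + n) * S - 2ℚ * (2ℚ * n + 1ℚ) * T ≡ - (3ℚ * n + 1ℚ - 2ℚ * k) * (x * x) →
           y′ ≡ x + y → (1ℚ + k) * y ≡ (n - k) * x →
           (1ℚ + n) * (S + y′ * y′) - 2ℚ * (2ℚ * n + 1ℚ) * (T + y * y)
           ≡ - (3ℚ * n + 1ℚ - 2ℚ * (1ℚ + k)) * (y * y)
    step n k x y y′ S T eq₁ refl eq₂ =
      -- What remains is a quadratic form in x and y, which factors as 2(x - y) times the absorption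
      -- relation.
      linear₂ 1ℚ (2ℚ * (x - y)) eq₁ eq₂ (solve (n ∷ k ∷ x ∷ y ∷ S ∷ T ∷ []) ℚ-ring)

  -- At k = n + 1 the entry n C (n + 1) is zero, so the certificate vanishes and the sums satisfy
  -- the recurrence of the central binomial coefficients.
  Σc²≡central : ∀ n → Σ< (λ j → c n j * c n j) (suc n) ≡ c (2 ℕ.* n) n
  Σc²≡central zero    = refl
  Σc²≡central (suc n) = *-cancelˡ-≢0 (ι-suc≢0 n)
    (step (ι n) _ (Σ< (λ j → c n j * c n j) (suc n)) (c n (suc n)) (c (2 ℕ.* n) n) (c (2 ℕ.* suc n) (suc n))
      (Σc²-certificate n (suc n)) (cong ι (k>n⇒nCk≡0 (ℕ.n<1+n n))) (Σc²≡central n) (c-central-suc n))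
    where
    step : ∀ n S T y d d′ →
           (1ℚ + n) * S - 2ℚ * (2ℚ * n + 1ℚ) * (T + y * y) ≡ - (3ℚ * n + 1ℚ - 2ℚ * (1ℚ + n)) * (y * y) →
           y ≡ 0ℚ → T ≡ d → (1ℚ + n) * d′ ≡ 2ℚ * (2ℚ * n + 1ℚ) * d →
           (1ℚ + n) * S ≡ (1ℚ + n) * d′
    step n S T y d d′ eq₁ refl refl eq₂ =
      linear₂ 1ℚ (- 1ℚ) eq₁ eq₂ (solve (n ∷ S ∷ T ∷ d′ ∷ []) ℚ-ring)

  fac-central : ∀ n → fac (2 ℕ.* n) ≡ c (2 ℕ.* n) n * (fac n * fac n)
  fac-central zero    = refl
  fac-central (suc n) = trans (cong fac (ℕ.*-suc 2 n))
    (step (ι n) (ι (2 ℕ.* n)) (fac n) (fac (2 ℕ.* n)) (c (2 ℕ.* n) n) (c (2 ℕ.* suc n) (suc n))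
      (ι-* 2 n) (fac-central n) (c-central-suc n))
    where
    step : ∀ n m f g d d′ → m ≡ 2ℚ * n → g ≡ d * (f * f) → (1ℚ + n) * d′ ≡ 2ℚ * (2ℚ * n + 1ℚ) * d →
           (1ℚ + (1ℚ + m)) * ((1ℚ + m) * g) ≡ d′ * ((1ℚ + n) * f * ((1ℚ + n) * f))
    step n m f g d d′ refl refl eq = linear₁ (- ((1ℚ + n) * (f * f))) eq (solve (n ∷ f ∷ d ∷ d′ ∷ []) ℚ-ring)

  ¼ : ℚ
  ¼ = ½ * ½

  ¼^ : ℕ → ℚ
  ¼^ zero    = 1ℚ
  ¼^ (suc n) = ¼ * ¼^ n

  -- Both sides obey the same first-order recurrence. This form shows that b_n is p-integral for odd
  -- p.
  b-central : ∀ n → b n ≡ c (2 ℕ.* n) n * ¼^ n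
  b-central zero    = refl
  b-central (suc n) =
    step (ι n) (1/2suc n) (b n) (¼^ n) (c (2 ℕ.* n) n) (c (2 ℕ.* suc n) (suc n))
      (1/2suc-inverse n) (b-central n) (c-central-suc n)
    where
    step : ∀ n h b q d d′ → h * (2ℚ * (1ℚ + n)) ≡ 1ℚ → b ≡ d * q →
           (1ℚ + n) * d′ ≡ 2ℚ * (2ℚ * n + 1ℚ) * d →
           b * ((2ℚ * n + 1ℚ) * h) ≡ d′ * (¼ * q)
    step n h b q d d′ eq₁ refl eq₂ =
      linear₂ (d′ * q * ¼) (- (½ * h * q)) eq₁ eq₂ (solve (n ∷ h ∷ q ∷ d ∷ d′ ∷ []) ℚ-ring)

  -- Take j = m in `u-P`, leaving m + 1. Here (1/2)_n = b_n n! with n! = (2m + 1) (2m C m) m!²,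
  -- while (1/2)_(m+1) is (2m + 1)/2 times (1/2)_m; the common factors cancel.
  u-middle : ∀ m → 2ℚ * b (suc (2 ℕ.* m)) * c (2 ℕ.* m) m ≡ sgn m * u (ι (suc (2 ℕ.* m))) m
  u-middle m = *-cancelˡ-≢0 (*-≢0 (2n+1≢0 m) (*-≢0 (P≢0 m) (*-≢0 (fac≢0 m) (fac≢0 m))))
    (step (ι m) (ι (2 ℕ.* m)) (u (ι n) m) (fac m) (fac (2 ℕ.* m)) (c (2 ℕ.* m) m) (sgn m) (b n) (P m) (P (suc m))
      (ι-* 2 m) (fac-central m) (P-suc m) (u-P m (suc m) n m+1+m≡n) (sgn-square m))
    where
    n = suc (2 ℕ.* m)
    m+1+m≡n : m ℕ.+ suc m ≡ n
    m+1+m≡n = trans (ℕ.+-suc m m) (cong (λ k → suc (m ℕ.+ k)) (sym (ℕ.+-identityʳ m)))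
    sgn-square : ∀ n → sgn n * sgn n ≡ 1ℚ
    sgn-square zero    = refl
    sgn-square (suc n) = trans (id (sgn n)) (sgn-square n)
      where
      id : ∀ s → - s * - s ≡ s * s
      id = solve-∀ ℚ-ring
    step : ∀ m k u f g d s b P P′ → k ≡ 2ℚ * m → g ≡ d * (f * f) → 2ℚ * P′ ≡ (2ℚ * m + 1ℚ) * P →
           u * (f * f) * P′ ≡ s * P * (b * ((1ℚ + k) * g)) → s * s ≡ 1ℚ →
           (2ℚ * m + 1ℚ) * (P * (f * f)) * (2ℚ * b * d) ≡ (2ℚ * m + 1ℚ) * (P * (f * f)) * (s * u)
    step m k u f g d s b P P′ refl refl eq₁ eq₂ eq₃ =
      linear₃ (u * (f * f) * s) (- 2ℚ * s) (- (2ℚ * P * b * (1ℚ + 2ℚ * m) * d * (f * f))) eq₁ eq₂ eq₃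
        (solve (m ∷ u ∷ f ∷ d ∷ s ∷ b ∷ P ∷ P′ ∷ []) ℚ-ring)

  -- Congruences modulo p²

  ∑≡Σ< : ∀ (f : ℕ → ℚ) n → ∑[ i < n ] f (toℕ i) ≡ Σ< f n
  ∑≡Σ< f zero    = refl
  ∑≡Σ< f (suc n) = trans (sum-init-last {n} (f ∘ toℕ))
    (cong₂ _+_ (trans (sum-cong-≗ {n} (λ i → cong f (toℕ-inject₁ i))) (∑≡Σ< f n)) (cong f (toℕ-fromℕ n)))

  Σ<-cong : ∀ {f g : ℕ → ℚ} → (∀ n → f n ≡ g n) → ∀ n → Σ< f n ≡ Σ< g n
  Σ<-cong f≗g zero    = refl
  Σ<-cong f≗g (suc n) = cong₂ _+_ (Σ<-cong f≗g n) (f≗g n)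

  Σ<-split : ∀ f m n → Σ< f (m ℕ.+ n) ≡ Σ< f n + Σ< (λ i → f (i ℕ.+ n)) m
  Σ<-split f zero    n = sym (ℚ.+-identityʳ (Σ< f n))
  Σ<-split f (suc m) n = trans (cong (_+ f (m ℕ.+ n)) (Σ<-split f m n)) (ℚ.+-assoc (Σ< f n) _ _)

  -- The summand in terms of `b`

  -64ℤ : ℤ
  -64ℤ = ℤ.- (ℤ.+ 64)

  summand : ℕ → ℚ
  summand k = (fromℤ (ℤ.+ (4 ℕ.* k ℕ.+ 1)) ÷ fromℤ (-64ℤ ℤ.^ k)) {{fromℤ-^-nonZero -64ℤ k}}
              * fromℤ (ℤ.+ (((2 ℕ.* k) C k) ℕ.^ 3))

  -- Each step rests on (-64)(-1)(1/4)³ = 1.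
  -64^-inverse : ∀ k → fromℤ (-64ℤ ℤ.^ k) * (sgn k * (¼^ k * ¼^ k * ¼^ k)) ≡ 1ℚ
  -64^-inverse zero    = refl
  -64^-inverse (suc k) = trans (cong (_* (sgn (suc k) * (¼^ (suc k) * ¼^ (suc k) * ¼^ (suc k)))) (fromℤ-* -64ℤ (-64ℤ ℤ.^ k)))
    (trans (id (fromℤ (-64ℤ ℤ.^ k)) (sgn k) (¼^ k)) (-64^-inverse k))
    where
    id : ∀ x s q → fromℤ -64ℤ * x * (- s * (¼ * q * (¼ * q) * (¼ * q))) ≡ x * (s * (q * q * q))
    id = solve-∀ ℚ-ring

  -- Inverses are unique, so dividing by (-64)^k is multiplying by the inverse found in
  -- `-64^-inverse`.
  summand≡t : ∀ k → summand k ≡ t k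
  summand≡t k = step (fromℤ (-64ℤ ℤ.^ k)) _ (ι k) (sgn k) (¼^ k) (c (2 ℕ.* k) k)
    _ (b k) _ (ℚ.*-inverseˡ (fromℤ (-64ℤ ℤ.^ k)) {{fromℤ-^-nonZero -64ℤ k}}) (-64^-inverse k)
    4k+1 (b-central k) cube
    where
    4k+1 : fromℤ (ℤ.+ (4 ℕ.* k ℕ.+ 1)) ≡ 4ℚ * ι k + 1ℚ
    4k+1 = trans (sym (ι≡fromℤ (4 ℕ.* k ℕ.+ 1))) (trans (ι-+ (4 ℕ.* k) 1) (cong (_+ 1ℚ) (ι-* 4 k)))
    m = (2 ℕ.* k) C k
    cube : fromℤ (ℤ.+ (m ℕ.^ 3)) ≡ ι m * (ι m * (ι m * 1ℚ))
    cube = trans (sym (ι≡fromℤ (m ℕ.^ 3))) (trans (ι-* m (m ℕ.^ 2)) (cong (ι m *_)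
      (trans (ι-* m (m ℕ.^ 1)) (cong (ι m *_) (ι-* m 1)))))
    step : ∀ w w⁻¹ x s q d a b d³ → w⁻¹ * w ≡ 1ℚ → w * (s * (q * q * q)) ≡ 1ℚ →
           a ≡ 4ℚ * x + 1ℚ → b ≡ d * q → d³ ≡ d * (d * (d * 1ℚ)) →
           a * w⁻¹ * d³ ≡ (4ℚ * x + 1ℚ) * s * (b * b * b)
    step w w⁻¹ x s q d a b d³ eq₁ eq₂ refl refl refl =
      linear₂ ((4ℚ * x + 1ℚ) * d * d * d * s * q * q * q) (- ((4ℚ * x + 1ℚ) * d * d * d * w⁻¹)) eq₁ eq₂
        (solve (w ∷ w⁻¹ ∷ x ∷ s ∷ q ∷ d ∷ []) ℚ-ring)

  -- The harmonic triangle i! l! / (i + l + 1)!.  Its additive recurrence makes n · Leibniz i l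
  -- an integral combination of the n / k with i < k ≤ i + l + 1.
  Leibniz : ℕ → ℕ → ℚ
  Leibniz i zero    = 1/suc i
  Leibniz i (suc l) = Leibniz i l - Leibniz (suc i) l

  -- The ratios of neighbours identify the difference triangle with the factorial formula. The two
  -- directions are proved by mutual recursion on l: the right-hand one follows from the left-hand
  -- one by subtraction.
  Leibniz-sucˡ : ∀ i l → (2ℚ + ι i + ι l) * Leibniz (suc i) l ≡ (1ℚ + ι i) * Leibniz i l
  Leibniz-sucʳ : ∀ i l → (2ℚ + ι i + ι l) * Leibniz i (suc l) ≡ (1ℚ + ι l) * Leibniz i l

  Leibniz-sucˡ i zero    = step (ι i) (1/suc i) (1/suc (suc i)) (1/suc-inverse i) (1/suc-inverse (suc i))
    where
    step : ∀ i y z → y * (1ℚ + i) ≡ 1ℚ → z * (1ℚ + (1ℚ + i)) ≡ 1ℚ → (2ℚ + i + 0ℚ) * z ≡ (1ℚ + i) * y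
    step i y z eq₁ eq₂ = linear₂ (- 1ℚ) 1ℚ eq₁ eq₂ (solve (i ∷ y ∷ z ∷ []) ℚ-ring)
  Leibniz-sucˡ i (suc l) = *-cancelˡ-≢0 2+i+l≢0
    (step (ι i) (ι l) (Leibniz i l) (Leibniz (suc i) l) (Leibniz (suc i) (suc l))
      (Leibniz-sucʳ (suc i) l) (Leibniz-sucˡ i l))
    where
    2+i+l≢0 : 2ℚ + ι i + ι l ≢ 0ℚ
    2+i+l≢0 eq = ι-suc≢0 (suc (i ℕ.+ l)) (trans (trans (cong (λ x → 1ℚ + (1ℚ + x)) (ι-+ i l)) (id (ι i) (ι l))) eq)
      where
      id : ∀ x y → 1ℚ + (1ℚ + (x + y)) ≡ 2ℚ + x + y
      id = solve-∀ ℚ-ring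
    step : ∀ i l x y z → (2ℚ + (1ℚ + i) + l) * z ≡ (1ℚ + l) * y → (2ℚ + i + l) * y ≡ (1ℚ + i) * x →
           (2ℚ + i + l) * ((2ℚ + i + (1ℚ + l)) * z) ≡ (2ℚ + i + l) * ((1ℚ + i) * (x - y))
    step i l x y z eq₁ eq₂ = linear₂ (2ℚ + i + l) (2ℚ + i + l) eq₁ eq₂
      (solve (i ∷ l ∷ x ∷ y ∷ z ∷ []) ℚ-ring)

  Leibniz-sucʳ i l = step (ι i) (ι l) (Leibniz i l) (Leibniz (suc i) l) (Leibniz-sucˡ i l)
    where
    step : ∀ i l x y → (2ℚ + i + l) * y ≡ (1ℚ + i) * x → (2ℚ + i + l) * (x - y) ≡ (1ℚ + l) * x
    step i l x y eq = linear₁ (- 1ℚ) eq (solve (i ∷ l ∷ x ∷ y ∷ []) ℚ-ring)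

  -- The ratio of consecutive terms is a square up to a factor near 1: (2j + 1)(2j + 1 - 2x) = (2j +
  -- 1 - x)² - x² = 4s² (1 - y²/4), where 2s = ±(2j + 1 - x) and y = x/s.
  u-square-step : ∀ x j h z e y s → (2ℚ * j + 1ℚ - x) * (2ℚ * j + 1ℚ - x) ≡ 4ℚ * (s * s) → y * s ≡ x →
                  z * z * e * ((2ℚ * j + 1ℚ) * (2ℚ * j + 1ℚ - 2ℚ * x) * (h * h))
                  ≡ 2ℚ * h * s * z * (2ℚ * h * s * z) * (e * (1ℚ - ¼ * (y * y)))
  u-square-step x j h z e y s eq₁ eq₂ =
    linear₂ (z * z * e * (h * h)) (z * z * e * (h * h) * (y * s + x)) eq₁ eq₂
      (solve (x ∷ j ∷ h ∷ z ∷ e ∷ y ∷ s ∷ []) ℚ-ring)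

  -- Congruences for `u` and the sum at an odd prime

  module _ {p : ℕ} (p-prime : Prime p) (2∤p : 2 ∤ p) where

    p∤2 : p ∤ 2
    p∤2 p∣2 = 2∤p (subst (2 ∣_)
      (ℕ.≤-antisym (ℕ.nonTrivial⇒n>1 p {{Prime.prime⇒nonTrivial p-prime}}) (ℕ.∣⇒≤ p∣2)) ℕ.∣-refl)

    Divides-¼ : Divides p 0 ¼
    Divides-¼ = Divides-* p-prime ½-integral ½-integral
      where
      ½-integral : Divides p 0 ½
      ½-integral = Divides-unit p-prime p∤2 refl

    Divides-b : ∀ n → Divides p 0 (b n)
    Divides-b n = subst (Divides p 0) (sym (b-central n))
      (Divides-* p-prime (Divides-ι p-prime ((2 ℕ.* n) C n)) (¼^-integral n))
      where
      ¼^-integral : ∀ n → Divides p 0 (¼^ n)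
      ¼^-integral zero    = Divides-ι p-prime 1
      ¼^-integral (suc n) = Divides-* p-prime Divides-¼ (¼^-integral n)

    Divides-sgn : ∀ n → Divides p 0 (sgn n)
    Divides-sgn zero    = Divides-ι p-prime 1
    Divides-sgn (suc n) = Divides-- p-prime (Divides-sgn n)

    Divides-Σ : ∀ {m} f n → (∀ j → j ℕ.< n → Divides p m (f j)) → Divides p m (Σ< f n)
    Divides-Σ {m} f zero    h = Divides-0 p-prime m
    Divides-Σ     f (suc n) h =
      Divides-+ p-prime (Divides-Σ f n (λ j j<n → h j (ℕ.m<n⇒m<1+n j<n))) (h n (ℕ.n<1+n n))

    Divides-Σ-difference : ∀ {m} f g n → (∀ j → j ℕ.< n → Divides p m (f j - g j)) →
                           Divides p m (Σ< f n - Σ< g n)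
    Divides-Σ-difference {m} f g zero    h = Divides-0 p-prime m
    Divides-Σ-difference {m} f g (suc n) h = subst (Divides p m) (id (Σ< f n) (Σ< g n) (f n) (g n))
      (Divides-+ p-prime (Divides-Σ-difference f g n (λ j j<n → h j (ℕ.m<n⇒m<1+n j<n))) (h n (ℕ.n<1+n n)))
      where
      id : ∀ x y z w → x - y + (z - w) ≡ x + z - (y + w)
      id = solve-∀ ℚ-ring

    module _ (r M : ℕ) (pʳ≡2M+1 : p ℕ.^ r ≡ suc (2 ℕ.* M)) where

      private
        N : ℕ
        N = suc (2 ℕ.* M)

        x : ℚ
        x = ι N

        x≡ : x ≡ 1ℚ + 2ℚ * ι M
        x≡ = cong (1ℚ +_) (ι-* 2 M)

        N≡M+M+1 : N ≡ M ℕ.+ suc M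
        N≡M+M+1 = trans (cong (λ k → suc (M ℕ.+ k)) (ℕ.+-identityʳ M)) (sym (ℕ.+-suc M M))

        y : ℕ → ℚ
        y s = x * 1/suc s

        y-equation : ∀ s → y s * (1ℚ + ι s) ≡ x
        y-equation s = trans (ℚ.*-assoc x (1/suc s) (ι (suc s)))
          (trans (cong (x *_) (1/suc-inverse s)) (ℚ.*-identityʳ x))

        Divides-y : ∀ s → suc s ℕ.< N → Divides p 1 (y s)
        Divides-y s s<N = Divides-p^/k p-prime r (suc s) ℕ.z<s (subst (suc s ℕ.<_) (sym pʳ≡2M+1) s<N)
          (trans (y-equation s) (cong ι (sym pʳ≡2M+1)))

        Divides-¼y² : ∀ s → suc s ℕ.< N → Divides p 2 (¼ * (y s * y s))
        Divides-¼y² s s<N = Divides-* p-prime Divides-¼ (Divides-* p-prime (Divides-y s s<N) (Divides-y s s<N))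

        ≤M⇒<N : ∀ {s} → s ℕ.≤ M → s ℕ.< N
        ≤M⇒<N s≤M = ℕ.s≤s (ℕ.≤-trans s≤M (ℕ.m≤m+n M (M ℕ.+ 0)))

        -- `e` collects the factors 1 - y²/4. Below the middle it starts from 1 and stays ≡ 1 modulo
        -- p²; above, it starts from -u(M)/4, and being p-integral suffices because the square
        -- already supplies p².
        Lower Upper : ℕ → Set
        Lower j = ∃ λ e → u x j ≡ c M j * c M j * e × Divides p 2 (e - 1ℚ)
        Upper l = ∃ λ e → u x (l ℕ.+ suc M) ≡ x * Leibniz M l * (x * Leibniz M l) * e × Divides p 0 e

      -- Here 2j + 1 - N = -2(s + 1), and (s + 1)/(j + 1) is the ratio of consecutive binomial
      -- coefficients in row M. Since s + 1 ≤ M < N, the new factor of `e` is ≡ 1 modulo p².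
      u-lower-suc : ∀ j s → j ℕ.+ suc s ≡ M → Lower j → Lower (suc j)
      u-lower-suc j s eq (e , u≡c²e , e≡1) = e * (1ℚ - ¼ * (y s * y s))
        , trans (cong (_* ((2ℚ * ι j + 1ℚ) * (2ℚ * ι j + 1ℚ - 2ℚ * x) * (1/2suc j * 1/2suc j))) u≡c²e)
            (trans (u-square-step x (ι j) (1/2suc j) (c M j) e (y s) (1ℚ + ι s)
                     (difference (ι j) (ι M) (ι s) x x≡ M≡) (y-equation s))
                   (cong (λ d → d * d * (e * (1ℚ - ¼ * (y s * y s)))) (sym c-suc)))
        , subst (Divides p 2) (id e (¼ * (y s * y s)))
            (Divides-+ p-prime e≡1 (Divides-- p-prime (Divides-* p-prime {0} e-integral
              (Divides-¼y² s (≤M⇒<N (subst (suc s ℕ.≤_) eq (ℕ.m≤n+m (suc s) j)))))))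
        where
        M≡ : ι M ≡ ι j + (1ℚ + ι s)
        M≡ = trans (cong ι (sym eq)) (ι-+ j (suc s))
        difference : ∀ j m s x → x ≡ 1ℚ + 2ℚ * m → m ≡ j + (1ℚ + s) →
                     (2ℚ * j + 1ℚ - x) * (2ℚ * j + 1ℚ - x) ≡ 4ℚ * ((1ℚ + s) * (1ℚ + s))
        difference j m s x refl refl = solve (j ∷ s ∷ []) ℚ-ring
        c-suc : c M (suc j) ≡ 2ℚ * 1/2suc j * (1ℚ + ι s) * c M j
        c-suc = step (1/2suc j) (ι j) (ι M) (ι s) (c M j) (c M (suc j)) (1/2suc-inverse j) (c-absorb M j) M≡
          where
          step : ∀ h j m s d d′ → h * (2ℚ * (1ℚ + j)) ≡ 1ℚ → (1ℚ + j) * d′ ≡ (m - j) * d → m ≡ j + (1ℚ + s) →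
                 d′ ≡ 2ℚ * h * (1ℚ + s) * d
          step h j m s d d′ eq₁ eq₂ refl =
            linear₂ (- d′) (2ℚ * h) eq₁ eq₂ (solve (h ∷ j ∷ s ∷ d ∷ d′ ∷ []) ℚ-ring)
        e-integral : Divides p 0 e
        e-integral = subst (Divides p 0) (id₀ e)
          (Divides-+ p-prime (Divides-weaken p-prime e≡1) (Divides-ι p-prime 1))
          where
          id₀ : ∀ e → e - 1ℚ + 1ℚ ≡ e
          id₀ = solve-∀ ℚ-ring
        id : ∀ e q → e - 1ℚ + - (e * q) ≡ e * (1ℚ - q) - 1ℚ
        id = solve-∀ ℚ-ring

      u-lower : ∀ j s → j ℕ.+ s ≡ M → Lower j
      u-lower zero    s eq = 1ℚ , refl , Divides-0 p-prime 2
      u-lower (suc j) s eq = u-lower-suc j s eq′ (u-lower j (suc s) eq′)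
        where eq′ = trans (ℕ.+-suc j s) eq

      Divides-u-c² : ∀ j → j ℕ.< suc M → Divides p 2 (u x j - c M j * c M j)
      Divides-u-c² j j<1+M = difference (u-lower j (M ℕ.∸ j) (ℕ.m+[n∸m]≡n (ℕ.≤-pred j<1+M)))
        where
        difference : Lower j → Divides p 2 (u x j - c M j * c M j)
        difference (e , u≡c²e , e≡1) = subst (Divides p 2)
          (trans (id (c M j * c M j) e) (cong (_- c M j * c M j) (sym u≡c²e)))
          (Divides-* p-prime {0} (Divides-* p-prime (Divides-ι p-prime (M C j)) (Divides-ι p-prime (M C j))) e≡1)
          where
          id : ∀ d e → d * (e - 1ℚ) ≡ d * e - d
          id = solve-∀ ℚ-ring

      -- The differences reach only N/k with i < k ≤ i + l + 1, and each of these is divisible by p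
      -- because k < N.
      Divides-Leibniz : ∀ i l → suc i ℕ.+ l ℕ.< N → Divides p 1 (x * Leibniz i l)
      Divides-Leibniz i zero    i<N = Divides-y i (subst (ℕ._< N) (cong suc (ℕ.+-identityʳ i)) i<N)
      Divides-Leibniz i (suc l) i<N = subst (Divides p 1) (id x (Leibniz i l) (Leibniz (suc i) l))
        (Divides-+ p-prime (Divides-Leibniz i l (ℕ.<-trans (ℕ.n<1+n _) i+l<N))
                           (Divides-- p-prime (Divides-Leibniz (suc i) l i+l<N)))
        where
        i+l<N : suc (suc i) ℕ.+ l ℕ.< N
        i+l<N = subst (ℕ._< N) (cong suc (ℕ.+-suc i l)) i<N
        id : ∀ x y z → x * y + - (x * z) ≡ x * (y - z)
        id = solve-∀ ℚ-ring

      -- Passing j = M multiplies by (2M + 1)(2M + 1 - 2N) = -N², which is where the square of N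
      -- enters.
      u-upper-zero : Upper 0
      u-upper-zero = - (¼ * u x M)
        , step (ι M) x (1/suc M) (u x M) x≡
        , Divides-- p-prime (Divides-* p-prime Divides-¼ u-integral)
        where
        step : ∀ m x i v → x ≡ 1ℚ + 2ℚ * m →
               v * ((2ℚ * m + 1ℚ) * (2ℚ * m + 1ℚ - 2ℚ * x) * (½ * i * (½ * i))) ≡ x * i * (x * i) * - (¼ * v)
        step m x i v refl = solve (m ∷ i ∷ v ∷ []) ℚ-ring
        u-integral : Divides p 0 (u x M)
        u-integral = subst (Divides p 0) (id (u x M) (c M M * c M M))
          (Divides-+ p-prime (Divides-weaken p-prime (Divides-u-c² M (ℕ.n<1+n M)))
            (Divides-* p-prime (Divides-ι p-prime (M C M)) (Divides-ι p-prime (M C M))))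
          where
          id : ∀ v d → v - d + d ≡ v
          id = solve-∀ ℚ-ring

      -- Now 2j + 1 - N = 2(l + 1), and (l + 1)/(j + 1) is the ratio of neighbours in row M of the
      -- harmonic triangle.
      u-upper-suc : ∀ l → suc l ℕ.< M → Upper l → Upper (suc l)
      u-upper-suc l l<M (e , u≡ , e-integral) = e * (1ℚ - ¼ * (y l * y l))
        , trans (cong (_* ((2ℚ * ι j + 1ℚ) * (2ℚ * ι j + 1ℚ - 2ℚ * x) * (1/2suc j * 1/2suc j))) u≡)
            (trans (u-square-step x (ι j) (1/2suc j) (x * Leibniz M l) e (y l) (1ℚ + ι l)
                     (difference (ι j) (ι M) (ι l) x x≡ j≡) (y-equation l))
                   (cong (λ d → d * d * (e * (1ℚ - ¼ * (y l * y l)))) (sym Leibniz-suc)))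
        , Divides-* p-prime e-integral (Divides-+ p-prime (Divides-ι p-prime 1)
            (Divides-- p-prime (Divides-weaken p-prime (Divides-¼y² l (≤M⇒<N (ℕ.<⇒≤ l<M))))))
        where
        j : ℕ
        j = l ℕ.+ suc M
        j≡ : ι j ≡ ι l + (1ℚ + ι M)
        j≡ = ι-+ l (suc M)
        difference : ∀ j m l x → x ≡ 1ℚ + 2ℚ * m → j ≡ l + (1ℚ + m) →
                     (2ℚ * j + 1ℚ - x) * (2ℚ * j + 1ℚ - x) ≡ 4ℚ * ((1ℚ + l) * (1ℚ + l))
        difference j m l x refl refl = solve (m ∷ l ∷ []) ℚ-ring
        Leibniz-suc : x * Leibniz M (suc l) ≡ 2ℚ * 1/2suc j * (1ℚ + ι l) * (x * Leibniz M l)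
        Leibniz-suc = step (1/2suc j) (ι j) (ι M) (ι l) x (Leibniz M l) (Leibniz M (suc l))
          (1/2suc-inverse j) j≡ (Leibniz-sucʳ M l)
          where
          step : ∀ h j m l x d d′ → h * (2ℚ * (1ℚ + j)) ≡ 1ℚ → j ≡ l + (1ℚ + m) →
                 (2ℚ + m + l) * d′ ≡ (1ℚ + l) * d → x * d′ ≡ 2ℚ * h * (1ℚ + l) * (x * d)
          step h j m l x d d′ eq₁ refl eq₂ =
            linear₂ (- (x * d′)) (2ℚ * h * x) eq₁ eq₂ (solve (h ∷ m ∷ l ∷ x ∷ d ∷ d′ ∷ []) ℚ-ring)

      u-upper : ∀ l → l ℕ.< M → Upper l
      u-upper zero    _   = u-upper-zero
      u-upper (suc l) l<M = u-upper-suc l l<M (u-upper l (ℕ.<-trans (ℕ.n<1+n l) l<M))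

      Divides-Σu-central : Divides p 2 (Σ< (u x) N - c (2 ℕ.* M) M)
      Divides-Σu-central = subst (Divides p 2) rearrange
        (Divides-+ p-prime (Divides-Σ-difference (u x) (λ j → c M j * c M j) (suc M) Divides-u-c²)
          (Divides-Σ (λ l → u x (l ℕ.+ suc M)) M upper))
        where
        id : ∀ x y z → x - y + z ≡ x + z - y
        id = solve-∀ ℚ-ring
        upper : ∀ l → l ℕ.< M → Divides p 2 (u x (l ℕ.+ suc M))
        upper l l<M = divisible (u-upper l l<M)
          where
          z-divisible : Divides p 1 (x * Leibniz M l)
          -- The largest denominator involved is M + l + 1, below N because l < M.
          z-divisible = Divides-Leibniz M l (subst (suc M ℕ.+ l ℕ.<_) (trans (ℕ.+-comm (suc M) M) (sym N≡M+M+1))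
            (ℕ.+-monoʳ-< (suc M) l<M))
          divisible : Upper l → Divides p 2 (u x (l ℕ.+ suc M))
          divisible (e , u≡ , e-integral) = subst (Divides p 2) (sym u≡)
            (Divides-* p-prime {2} (Divides-* p-prime z-divisible z-divisible) e-integral)
        rearrange : Σ< (u x) (suc M) - Σ< (λ j → c M j * c M j) (suc M) + Σ< (λ l → u x (l ℕ.+ suc M)) M
                    ≡ Σ< (u x) N - c (2 ℕ.* M) M
        rearrange = trans (id (Σ< (u x) (suc M)) _ _)
          (cong₂ _-_ (trans (sym (Σ<-split (u x) M (suc M))) (cong (Σ< (u x)) (sym N≡M+M+1))) (Σc²≡central M))

      -- By `u-middle` the difference is N times a bracket: N supplies p^r, and the bracket supplies
      -- p² through the congruences for the sum of `u` and for u(M).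
      Divides-Σt : Divides p (r ℕ.+ 2) (Σ< t (p ℕ.^ r) - sgn M * ι (p ℕ.^ r))
      Divides-Σt rewrite pʳ≡2M+1 = subst (Divides p (r ℕ.+ 2))
        (trans (step x (b N) (Σ< (u x) N) (c (2 ℕ.* M) M) (sgn M) (u x M) (u-middle M))
          (cong (_- sgn M * x) (sym (Σt≡2nbΣu N))))
        (Divides-* p-prime {r} (subst (λ k → Divides p r (ι k)) pʳ≡2M+1 (Divides-p^ p-prime r))
          (Divides-+ p-prime
            (Divides-* p-prime {0} (Divides-* p-prime (Divides-ι p-prime 2) (Divides-b N)) Divides-Σu-central)
            (Divides-* p-prime {0} (Divides-sgn M)
              -- At j = M the squared binomial coefficient is 1.
              (subst (λ d → Divides p 2 (u x M - d)) (cong (λ k → ι k * ι k) (nCn≡1 M)) (Divides-u-c² M (ℕ.n<1+n M))))))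
        where
        step : ∀ x b T d s v → 2ℚ * b * d ≡ s * v →
               x * (2ℚ * b * (T - d) + s * (v - 1ℚ)) ≡ 2ℚ * x * b * T - s * x
        step x b T d s v eq = linear₁ (- x) eq (solve (x ∷ b ∷ T ∷ d ∷ s ∷ v ∷ []) ℚ-ring)

  -- Signs, odd powers and the final assembly

  sgn-+ : ∀ m n → sgn (m ℕ.+ n) ≡ sgn m * sgn n
  sgn-+ zero    n = sym (ℚ.*-identityˡ (sgn n))
  sgn-+ (suc m) n = trans (cong -_ (sgn-+ m n)) (ℚ.neg-distribˡ-* (sgn m) (sgn n))

  sgn-double : ∀ n → sgn (2 ℕ.* n) ≡ 1ℚ
  sgn-double zero    = refl
  sgn-double (suc n) = trans (cong sgn (ℕ.*-suc 2 n)) (trans (id (sgn (2 ℕ.* n))) (sgn-double n))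
    where
    id : ∀ s → - - s ≡ s
    id = solve-∀ ℚ-ring

  fromℤ-sgn : ∀ n → fromℤ (-1ℤ ℤ.^ n) ≡ sgn n
  fromℤ-sgn zero    = refl
  fromℤ-sgn (suc n) = trans (fromℤ-* -1ℤ (-1ℤ ℤ.^ n)) (trans (cong (fromℤ -1ℤ *_) (fromℤ-sgn n)) (id (sgn n)))
    where
    id : ∀ s → fromℤ -1ℤ * s ≡ - s
    id = solve-∀ ℚ-ring

  odd⇒2h+1 : ∀ n → 2 ∤ n → ∃ λ h → n ≡ suc (2 ℕ.* h)
  odd⇒2h+1 zero          2∤0 = contradiction (2 ℕ.∣0) 2∤0
  odd⇒2h+1 (suc zero)    _   = 0 , refl
  odd⇒2h+1 (suc (suc n)) 2∤n+2 with odd⇒2h+1 n (λ 2∣n → 2∤n+2 (ℕ.∣m∣n⇒∣m+n ℕ.∣-refl 2∣n))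
  ... | h , refl = suc h , cong suc (sym (ℕ.*-suc 2 h))

  -- From (2h + 1)(2M + 1) = 2(h + M + 2hM) + 1, each further factor adds h to M up to the even
  -- number 2hM, which leaves the sign alone.
  odd-power : ∀ h r → ∃ λ M → suc (2 ℕ.* h) ℕ.^ r ≡ suc (2 ℕ.* M) × sgn (h ℕ.* r) ≡ sgn M
  odd-power h zero    = 0 , refl , cong sgn (ℕ.*-zeroʳ h)
  odd-power h (suc r) with odd-power h r
  ... | M , pʳ≡ , sgn≡ = h ℕ.+ (M ℕ.+ 2 ℕ.* (h ℕ.* M))
    , trans (cong (suc (2 ℕ.* h) ℕ.*_) pʳ≡) (expand h M)
    , (begin
      sgn (h ℕ.* suc r)                            ≡⟨ cong sgn (ℕ.*-suc h r) ⟩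
      sgn (h ℕ.+ h ℕ.* r)                          ≡⟨ sgn-+ h (h ℕ.* r) ⟩
      sgn h * sgn (h ℕ.* r)                        ≡⟨ cong (sgn h *_) sgn≡ ⟩
      sgn h * sgn M                                ≡⟨ cong (sgn h *_) (ℚ.*-identityʳ (sgn M)) ⟨
      sgn h * (sgn M * 1ℚ)                         ≡⟨ cong (λ s → sgn h * (sgn M * s)) (sgn-double (h ℕ.* M)) ⟨
      sgn h * (sgn M * sgn (2 ℕ.* (h ℕ.* M)))      ≡⟨ cong (sgn h *_) (sgn-+ M _) ⟨
      sgn h * sgn (M ℕ.+ 2 ℕ.* (h ℕ.* M))          ≡⟨ sgn-+ h _ ⟨
      sgn (h ℕ.+ (M ℕ.+ 2 ℕ.* (h ℕ.* M)))          ∎)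
    where
    open ≡-Reasoning
    expand : ∀ h M → suc (2 ℕ.* h) ℕ.* suc (2 ℕ.* M) ≡ suc (2 ℕ.* (h ℕ.+ (M ℕ.+ 2 ℕ.* (h ℕ.* M))))
    expand = ℕ-Solver.solve-∀

  module _ {p : ℕ} (p-prime : Prime p) (2∤p : 2 ∤ p) where

    -- For p = 2h + 1 the exponent is 2hr/2, so the truncating division is exact and gives hr.
    half-exponent-sign : ∀ r → ∃ λ M → p ℕ.^ r ≡ suc (2 ℕ.* M) ×
                    fromℤ (-1ℤ ℤ.^ (((p ℕ.∸ 1) ℕ.* r) ℕ./ 2)) ≡ sgn M
    half-exponent-sign r with odd⇒2h+1 p 2∤p
    ... | h , refl with odd-power h r
    ... | M , pʳ≡2M+1 , sgn≡ = M , pʳ≡2M+1 , (begin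
      fromℤ (-1ℤ ℤ.^ ((2 ℕ.* h ℕ.* r) ℕ./ 2))  ≡⟨ cong (λ k → fromℤ (-1ℤ ℤ.^ (k ℕ./ 2))) 2hr≡hr2 ⟩
      fromℤ (-1ℤ ℤ.^ ((h ℕ.* r ℕ.* 2) ℕ./ 2))  ≡⟨ cong (λ k → fromℤ (-1ℤ ℤ.^ k)) (m*n/n≡m (h ℕ.* r) 2) ⟩
      fromℤ (-1ℤ ℤ.^ (h ℕ.* r))                ≡⟨ fromℤ-sgn (h ℕ.* r) ⟩
      sgn (h ℕ.* r)                            ≡⟨ sgn≡ ⟩
      sgn M                                    ∎)
      where
      open ≡-Reasoning
      2hr≡hr2 : 2 ℕ.* h ℕ.* r ≡ h ℕ.* r ℕ.* 2
      2hr≡hr2 = trans (ℕ.*-assoc 2 h r) (ℕ.*-comm 2 (h ℕ.* r))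

    -- The positive exponent is written `suc r`, so that the exponent of the modulus is visibly a
    -- successor, as `Divides⇒≤ν` asks.
    summand-supercongruence : ∀ r → ∑[ i < p ℕ.^ suc r ] summand (toℕ i)
      ≡ fromℤ (-1ℤ ℤ.^ (((p ℕ.∸ 1) ℕ.* suc r) ℕ./ 2) ℤ.* (ℤ.+ (p ℕ.^ suc r))) [mod p ^ (suc r ℕ.+ 2) ]
    summand-supercongruence r with half-exponent-sign (suc r)
    ... | M , pʳ≡2M+1 , sgn≡ = Divides⇒≤ν p-prime _
      (subst (Divides p (suc r ℕ.+ 2)) (cong₂ _-_ (sym sum≡) (sym target≡))
        (Divides-Σt p-prime 2∤p (suc r) M pʳ≡2M+1))
      where
      N = p ℕ.^ suc r
      sum≡ : ∑[ i < N ] summand (toℕ i) ≡ Σ< t N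
      sum≡ = trans (∑≡Σ< summand N) (Σ<-cong summand≡t N)
      sign = -1ℤ ℤ.^ (((p ℕ.∸ 1) ℕ.* suc r) ℕ./ 2)
      target≡ : fromℤ (sign ℤ.* (ℤ.+ N)) ≡ sgn M * ι N
      target≡ = trans (fromℤ-* sign (ℤ.+ N)) (cong₂ _*_ sgn≡ (sym (ι≡fromℤ N)))

open import Data.Nat.Base using (ℕ; _<_; _+_; _*_; _∸_; _^_; _/_)
open import Data.Nat.Divisibility using (_∤_)
open import Data.Nat.Primality using (Prime)
open import Data.Nat.Combinatorics using (_C_)
open import Data.Integer.Base as ℤ using (+_; -1ℤ)
open import Data.Rational.Base as ℚ using (_÷_)
open import Data.Fin.Base using (toℕ)
open import Defs
open import Data.Nat.Base using (suc)

theorem1p6 : ∀ (p r : ℕ) → Prime p → 2 ∤ p → 0 < r →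
  (∑[ i < p ^ r ]
    (let k = toℕ i
         instance -64^k≢0 = fromℤ-^-nonZero (ℤ.- (+ 64)) k
     in
      (fromℤ (+ (4 * k + 1)) ÷ fromℤ ((ℤ.- (+ 64)) ℤ.^ k))
        ℚ.* fromℤ (+ (((2 * k) C k) ^ 3))))
  ≡ fromℤ (-1ℤ ℤ.^ (((p ∸ 1) * r) / 2) ℤ.* + (p ^ r))
  [mod p ^ (r + 2) ]
theorem1p6 p (suc r) p-prime 2∤p _ = Supercongruence.summand-supercongruence p-prime 2∤p r
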